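{- $\mathbf{KB}$ is strongly complete for $\mathrm{EL}^s$: for any $\mathcal{EL}$-formula $\varphi$ and any set $\Phi$ of $\mathcal{EL}$-formulas, if $\Phi\models_{\mathrm{EL}^s}\varphi$, then $\Phi\vdash_{\mathbf{KB}}\varphi$.
   Context: Fix a countably infinite set $\mathsf{Prop}$ and a finite nonempty set $\mathsf{Ag}$ of agents. $\mathcal{EL}$-formulas: $\varphi::=p\mid\neg\varphi\mid(\varphi\to\varphi)\mid K_a\varphi$ ($p\in\mathsf{Prop}$, $a\in\mathsf{Ag}$). A similarity model is $M=(W,A,E,C,\nu)$ with $W\neq\emptyset$, $A$ an arbitrary set, $E:W\times W\to\wp(A)$, $C:\mathsf{Ag}\to\wp(A)$, $\nu:W\to\wp(\mathsf{Prop})$, such that for all $s,t\in W$: $E(s,t)=A$ implies $s=t$, and $E(s,t)=E(t,s)$. Satisfaction: $M,s\models p$ iff $p\in\nu(s)$; Booleans as usual; $M,s\models K_a\psi$ iff $M,t\models\psi$ for all $t\in W$ with $C(a)\subseteq E(s,t)$. $\Phi\models_{\mathrm{EL}^s}\varphi$ means: every state of every similarity model satisfying all formulas of $\Phi$ satisfies $\varphi$. $\mathbf{KB}$: axioms are all instances of propositional tautologies, $K_a(\varphi\to\psi)\to(K_a\varphi\to K_a\psi)$, and $\varphi\to K_a\neg K_a\neg\varphi$; rules: from $\varphi$ and $\varphi\to\psi$ infer $\psi$; from $\varphi$ infer $K_a\varphi$. $\Phi\vdash_{\mathbf{KB}}\varphi$ means there is a finite $\Phi_0\subseteq\Phi$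 such that $\bigwedge\Phi_0\to\varphi$ is a theorem of $\mathbf{KB}$. -}

module Defs where

open import Data.Bool.Base using (Bool; true; not; _∨_)
open import Data.List.Base using (List; []; _∷_)
open import Data.List.Relation.Unary.All using (All)
open import Data.Nat.Base using (ℕ)
open import Data.Product.Base using (Σ-syntax; _×_)
open import Function.Bundles using (_↔_; Inverse)
open import Level using (0ℓ)
open import Relation.Binary.PropositionalEquality.Core using (_≡_)
open import Relation.Nullary.Negation.Core using (¬_)
open import Relation.Unary using (Pred; _∈_; _⊆_; _≐_; U)

infixr 6 _⇒_

-- Classical propositional formulas over the letters 0, 1, 2, …; they serve
-- only as schemata for the tautology axioms.
data PropForm : Set where
  var  : ℕ → PropForm
  neg  : PropForm → PropForm
  _⇒_  : PropForm → PropForm → PropForm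

eval : (ℕ → Bool) → PropForm → Bool
eval v (var i) = v i
eval v (neg α) = not (eval v α)
eval v (α ⇒ β) = not (eval v α) ∨ eval v β

Tautology : PropForm → Set
Tautology α = ∀ v → eval v α ≡ true

module EL (Atom Ag : Set) (atoms : ℕ ↔ Atom) where

  infixr 6 _⊃_
  infixr 7 _∧_
  infix  4 _,_⊨_ _⊨ᴱᴸˢ_ _⊢ᴷᴮ_

  data Formula : Set where
    atom : Atom → Formula
    ∼_   : Formula → Formula
    _⊃_  : Formula → Formula → Formula
    K    : Ag → Formula → Formula

  _∧_ : Formula → Formula → Formula
  φ ∧ ψ = ∼ (φ ⊃ ∼ ψ)

  -- The language has no primitive constants; the choice of atom is immaterial.
  ⊤ : Formula
  ⊤ = atom p₀ ⊃ atom p₀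
    where p₀ = Inverse.to atoms 0

  ⋀ : List Formula → Formula
  ⋀ []       = ⊤
  ⋀ (φ ∷ φs) = φ ∧ ⋀ φs

  record SimilarityModel : Set₁ where
    field
      W        : Set
      nonempty : W
      A        : Set
      E        : W → W → Pred A 0ℓ
      C        : Ag → Pred A 0ℓ
      ν        : W → Pred Atom 0ℓ
      E-full   : ∀ s t → E s t ≐ U → s ≡ t
      E-sym    : ∀ s t → E s t ≐ E t s

  open SimilarityModel

  _,_⊨_ : (M : SimilarityModel) → W M → Formula → Set
  M , s ⊨ atom p = p ∈ ν M s
  M , s ⊨ ∼ φ    = ¬ (M , s ⊨ φ)
  M , s ⊨ φ ⊃ ψ  = M , s ⊨ φ → M , s ⊨ ψ
  M , s ⊨ K a φ  = ∀ t → C M a ⊆ E M s t → M , t ⊨ φ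

  _⊨ᴱᴸˢ_ : Pred Formula 0ℓ → Formula → Set₁
  Φ ⊨ᴱᴸˢ φ = ∀ (M : SimilarityModel) (s : W M) →
             (∀ ψ → ψ ∈ Φ → M , s ⊨ ψ) → M , s ⊨ φ

  _[_] : PropForm → (ℕ → Formula) → Formula
  var i   [ σ ] = σ i
  neg α   [ σ ] = ∼ (α [ σ ])
  (α ⇒ β) [ σ ] = (α [ σ ]) ⊃ (β [ σ ])

  data KB : Formula → Set where
    taut : ∀ α (σ : ℕ → Formula) → Tautology α → KB (α [ σ ])
    dist : ∀ a φ ψ → KB (K a (φ ⊃ ψ) ⊃ (K a φ ⊃ K a ψ))
    symm : ∀ a φ → KB (φ ⊃ K a (∼ K a (∼ φ)))
    mp   : ∀ {φ ψ} → KB φ → KB (φ ⊃ ψ) → KB ψ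
    nec  : ∀ a {φ} → KB φ → KB (K a φ)

  _⊢ᴷᴮ_ : Pred Formula 0ℓ → Formula → Set
  Φ ⊢ᴷᴮ φ = Σ[ Φ₀ ∈ List Formula ] All (_∈ Φ) Φ₀ × KB (⋀ Φ₀ ⊃ φ)

{-# OPTIONS --safe #-}

-- Canonical model argument.  The worlds are the maximal consistent sets, and
-- axiom B makes every canonical relation symmetric.  The set A consists of the
-- agents together with one extra element: E(s,t) collects the agents whose
-- relation links s to t and never contains the extra element.  So E(s,t) = A
-- never holds, and no two worlds have to be identified.
module Submission where

open import Defs
open import Axiom.ExcludedMiddle using (ExcludedMiddle)
open import Data.Bool.Base using (Bool; true; false; T)
open import Data.Bool.Properties using (T?)
open import Data.Empty using (⊥; ⊥-elim)
open import Data.Fin.Base using (Fin)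
open import Data.List.Base using (List; []; _∷_; _++_; map; foldr; allFin; cartesianProductWith)
open import Data.List.Membership.Propositional using () renaming (_∈_ to _∈ˡ_)
open import Data.List.Membership.Propositional.Properties
  using (∈-++⁺ˡ; ∈-++⁺ʳ; ∈-map⁺; ∈-allFin; ∈-cartesianProductWith⁺)
open import Data.List.Relation.Unary.All using (All; []; _∷_)
open import Data.List.Relation.Unary.All.Properties using (++⁺)
open import Data.List.Relation.Unary.Any using (here; there)
open import Data.Maybe.Base using (Maybe; just; nothing)
open import Data.Nat.Base using (ℕ; zero; suc; _⊔_; _≤′_; ≤′-refl; ≤′-step)
open import Data.Nat.Properties using (m≤m⊔n; m≤n⊔m; ≤⇒≤′)
open import Data.Product.Base using (Σ-syntax; ∃-syntax; _×_; _,_)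
open import Data.Sum.Base using (_⊎_; inj₁; inj₂)
open import Data.Unit.Base using (tt)
open import Function.Base using (_∘_; id)
open import Function.Bundles using (_↔_; Inverse)
open import Level using (0ℓ)
open import Relation.Binary.PropositionalEquality using (refl; cong; subst; sym)
open import Relation.Nullary.Decidable
  using (yes; no; ⌊_⌋; toWitness; fromWitness; decidable-stable)
open import Relation.Nullary.Negation using (¬_; contradiction)
open import Relation.Unary using (Pred; _∈_; _⊆_; _∪_; ｛_｝; ∅)

-- Derivations from hypotheses over KB.

module Deduction (Atom Ag : Set) (atoms : ℕ ↔ Atom) where

  open EL Atom Ag atoms

  instantiate : Formula → Formula → Formula → ℕ → Formula
  instantiate φ ψ χ 0 = φ
  instantiate φ ψ χ 1 = ψ
  instantiate φ ψ χ _ = χ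

  weakening : ∀ φ ψ → KB (φ ⊃ ψ ⊃ φ)
  weakening φ ψ = taut (var 0 ⇒ var 1 ⇒ var 0) (instantiate φ ψ ψ) table
    where
    table : Tautology (var 0 ⇒ var 1 ⇒ var 0)
    table v with v 0 | v 1
    ... | false | _     = refl
    ... | true  | false = refl
    ... | true  | true  = refl

  distribution : ∀ φ ψ χ → KB ((φ ⊃ ψ ⊃ χ) ⊃ (φ ⊃ ψ) ⊃ φ ⊃ χ)
  distribution φ ψ χ = taut α (instantiate φ ψ χ) table
    where
    α = (var 0 ⇒ var 1 ⇒ var 2) ⇒ (var 0 ⇒ var 1) ⇒ var 0 ⇒ var 2
    table : Tautology α
    table v with v 0 | v 1 | v 2
    ... | false | _     | _     = refl
    ... | true  | false | _     = refl
    ... | true  | true  | false = refl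
    ... | true  | true  | true  = refl

  identity : ∀ φ → KB (φ ⊃ φ)
  identity φ = mp (weakening φ φ)
    (mp (weakening φ (φ ⊃ φ)) (distribution φ (φ ⊃ φ) φ))

  explosion : ∀ φ ψ → KB (∼ φ ⊃ φ ⊃ ψ)
  explosion φ ψ = taut (neg (var 0) ⇒ var 0 ⇒ var 1) (instantiate φ ψ ψ) table
    where
    table : Tautology (neg (var 0) ⇒ var 0 ⇒ var 1)
    table v with v 0
    ... | false = refl
    ... | true  = refl

  dichotomy : ∀ φ ψ → KB ((φ ⊃ ψ) ⊃ (∼ φ ⊃ ψ) ⊃ ψ)
  dichotomy φ ψ = taut α (instantiate φ ψ ψ) table
    where
    α = (var 0 ⇒ var 1) ⇒ (neg (var 0) ⇒ var 1) ⇒ var 1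
    table : Tautology α
    table v with v 0 | v 1
    ... | false | false = refl
    ... | false | true  = refl
    ... | true  | false = refl
    ... | true  | true  = refl

  ∼∼-intro : ∀ φ → KB (φ ⊃ ∼ ∼ φ)
  ∼∼-intro φ = taut (var 0 ⇒ neg (neg (var 0))) (λ _ → φ) table
    where
    table : Tautology (var 0 ⇒ neg (neg (var 0)))
    table v with v 0
    ... | false = refl
    ... | true  = refl

  ∧-elimˡ : ∀ φ ψ → KB (φ ∧ ψ ⊃ φ)
  ∧-elimˡ φ ψ = taut (neg (var 0 ⇒ neg (var 1)) ⇒ var 0) (instantiate φ ψ ψ) table
    where
    table : Tautology (neg (var 0 ⇒ neg (var 1)) ⇒ var 0)
    table v with v 0 | v 1
    ... | false | _     = refl
    ... | true  | false = refl
    ... | true  | true  = refl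

  ∧-elimʳ : ∀ φ ψ → KB (φ ∧ ψ ⊃ ψ)
  ∧-elimʳ φ ψ = taut (neg (var 0 ⇒ neg (var 1)) ⇒ var 1) (instantiate φ ψ ψ) table
    where
    table : Tautology (neg (var 0 ⇒ neg (var 1)) ⇒ var 1)
    table v with v 0 | v 1
    ... | false | _     = refl
    ... | true  | false = refl
    ... | true  | true  = refl

  infix 4 _⊢_

  -- Necessitation enters only through `thm`, so it never acts on hypotheses; this keeps the
  -- deduction theorem valid. Premises form an arbitrary predicate, and a finite conjunction appears
  -- only in `⊢⇒⊢ᴷᴮ`.
  data _⊢_ (Φ : Pred Formula 0ℓ) : Formula → Set where
    hyp : ∀ {φ} → φ ∈ Φ → Φ ⊢ φ
    thm : ∀ {φ} → KB φ → Φ ⊢ φ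
    mp  : ∀ {φ ψ} → Φ ⊢ φ → Φ ⊢ φ ⊃ ψ → Φ ⊢ ψ

  mono : ∀ {Φ Ψ} → Φ ⊆ Ψ → ∀ {φ} → Φ ⊢ φ → Ψ ⊢ φ
  mono Φ⊆Ψ (hyp h)  = hyp (Φ⊆Ψ h)
  mono Φ⊆Ψ (thm k)  = thm k
  mono Φ⊆Ψ (mp d e) = mp (mono Φ⊆Ψ d) (mono Φ⊆Ψ e)

  ∅⊢⇒KB : ∀ {φ} → ∅ ⊢ φ → KB φ
  ∅⊢⇒KB (thm k)  = k
  ∅⊢⇒KB (mp d e) = mp (∅⊢⇒KB d) (∅⊢⇒KB e)

  -- `weakening` and `distribution` carry the antecedent through theorems and modus ponens, so only
  -- the hypotheses need an argument. This yields the deduction theorem, composition of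
  -- implications, and the passage from a list of premises to its conjunction.
  relativise : ∀ {Φ Ψ χ} → (∀ {ψ} → ψ ∈ Ψ → Φ ⊢ χ ⊃ ψ) → ∀ {φ} → Ψ ⊢ φ → Φ ⊢ χ ⊃ φ
  relativise f (hyp h)  = f h
  relativise f (thm k)  = mp (thm k) (thm (weakening _ _))
  relativise f (mp d e) =
    mp (relativise f d) (mp (relativise f e) (thm (distribution _ _ _)))

  deduction : ∀ {Φ ψ φ} → Φ ∪ ｛ ψ ｝ ⊢ φ → Φ ⊢ ψ ⊃ φ
  deduction = relativise λ where
    (inj₁ h)    → mp (hyp h) (thm (weakening _ _))
    (inj₂ refl) → thm (identity _)

  by-cases : ∀ {Φ ψ φ} → Φ ∪ ｛ ψ ｝ ⊢ φ → Φ ∪ ｛ ∼ ψ ｝ ⊢ φ → Φ ⊢ φ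
  by-cases d e = mp (deduction e) (mp (deduction d) (thm (dichotomy _ _)))

  finitary : ∀ {Φ φ} → Φ ⊢ φ → Σ[ Φ₀ ∈ List Formula ] All (_∈ Φ) Φ₀ × ((_∈ˡ Φ₀) ⊢ φ)
  finitary (hyp h) = _ ∷ [] , h ∷ [] , hyp (here refl)
  finitary (thm k) = [] , [] , thm k
  finitary (mp d e) with finitary d | finitary e
  ... | xs , xs⊆ , d′ | ys , ys⊆ , e′ =
    xs ++ ys , ++⁺ xs⊆ ys⊆ , mp (mono ∈-++⁺ˡ d′) (mono (∈-++⁺ʳ xs) e′)

  ⋀-elim : ∀ {φs φ} → φ ∈ˡ φs → ∅ ⊢ ⋀ φs ⊃ φ
  ⋀-elim (here refl)             = thm (∧-elimˡ _ _)
  -- Composition of implications: the tail conjunction is the sole hypothesis, and it follows from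
  -- the whole conjunction.
  ⋀-elim {φs = _ ∷ φs} (there p) = relativise {Ψ = ｛ ⋀ φs ｝}
    (λ where refl → thm (∧-elimʳ _ _))
    (mp (hyp refl) (mono (λ ()) (⋀-elim p)))

  ⊢⇒⊢ᴷᴮ : ∀ {Φ φ} → Φ ⊢ φ → Φ ⊢ᴷᴮ φ
  ⊢⇒⊢ᴷᴮ d with finitary d
  ... | Φ₀ , Φ₀⊆Φ , d₀ = Φ₀ , Φ₀⊆Φ , ∅⊢⇒KB (relativise ⋀-elim d₀)

-- Enumeration of the formulas in finite stages.

module Enumeration (Atom Ag : Set) (atoms : ℕ ↔ Atom) {n : ℕ} (agents : Fin n ↔ Ag) where

  open EL Atom Ag atoms

  agentList : List Ag
  agentList = map (Inverse.to agents) (allFin n)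

  ∈-agentList : ∀ a → a ∈ˡ agentList
  ∈-agentList a = subst (_∈ˡ agentList) (Inverse.strictlyInverseˡ agents a)
    (∈-map⁺ (Inverse.to agents) (∈-allFin (Inverse.from agents a)))

  compounds : List Formula → List Formula
  compounds φs = map ∼_ φs
    ++ cartesianProductWith _⊃_ φs φs
    ++ cartesianProductWith K agentList φs

  -- The stages are cumulative, so subformulas found at different stages meet at the later one.
  -- Having finitely many agents keeps each stage a list.
  stage : ℕ → List Formula
  stage zero    = []
  stage (suc k) = atom (Inverse.to atoms k) ∷ stage k ++ compounds (stage k)

  stage-mono : ∀ {k l φ} → k ≤′ l → φ ∈ˡ stage k → φ ∈ˡ stage l
  stage-mono ≤′-refl       p = p
  stage-mono (≤′-step k≤l) p = there (∈-++⁺ˡ (stage-mono k≤l p))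

  compound∈stage : ∀ k {φ} → φ ∈ˡ compounds (stage k) → φ ∈ˡ stage (suc k)
  compound∈stage k p = there (∈-++⁺ʳ (stage k) p)

  enumerated : ∀ φ → ∃[ k ] φ ∈ˡ stage k
  enumerated (atom p) = suc (Inverse.from atoms p) ,
    here (cong atom (sym (Inverse.strictlyInverseˡ atoms p)))
  enumerated (∼ φ) with enumerated φ
  ... | k , p = suc k , compound∈stage k (∈-++⁺ˡ (∈-map⁺ ∼_ p))
  enumerated (φ ⊃ ψ) with enumerated φ | enumerated ψ
  ... | k , p | l , q = suc (k ⊔ l) , compound∈stage (k ⊔ l)
    (∈-++⁺ʳ (map ∼_ (stage (k ⊔ l))) (∈-++⁺ˡ (∈-cartesianProductWith⁺ _⊃_
      (stage-mono (≤⇒≤′ (m≤m⊔n k l)) p) (stage-mono (≤⇒≤′ (m≤n⊔m k l)) q))))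
  enumerated (K a φ) with enumerated φ
  ... | k , p = suc k , compound∈stage k
    (∈-++⁺ʳ (map ∼_ (stage k)) (∈-++⁺ʳ (cartesianProductWith _⊃_ (stage k) (stage k))
      (∈-cartesianProductWith⁺ K (∈-agentList a) p)))

-- Maximal consistent sets, the canonical model and completeness.

module Canonical (em : ExcludedMiddle 0ℓ)
  (Atom Ag : Set) (atoms : ℕ ↔ Atom) {n : ℕ} (agents : Fin n ↔ Ag) where

  open EL Atom Ag atoms
  open Deduction Atom Ag atoms
  open Enumeration Atom Ag atoms agents

  -- A maximal consistent set is given by a Bool-valued characteristic function:
  -- predicates on formulas live in Set₁, whereas the states of a model must form
  -- a Set.
  record World : Set where
    field
      member  : Formula → Bool
      theorem : ∀ {φ} → KB φ → T (member φ)
      detach  : ∀ {φ ψ} → T (member φ) → T (member (φ ⊃ ψ)) → T (member ψ)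
      ∼-sound : ∀ {φ} → T (member (∼ φ)) → ¬ T (member φ)
      ∼-compl : ∀ {φ} → ¬ T (member φ) → T (member (∼ φ))

  open World

  infix 4 _⊩_

  _⊩_ : World → Formula → Set
  w ⊩ φ = T (member w φ)

  -- Among the extensions of Φ we look for a maximal one that does not derive φ.
  module Lindenbaum (Φ : Pred Formula 0ℓ) (φ : Formula) (Φ⊬φ : ¬ (Φ ⊢ φ)) where

    decide : Formula → Pred Formula 0ℓ → Pred Formula 0ℓ
    decide ψ Ψ with em {Ψ ∪ ｛ ψ ｝ ⊢ φ}
    ... | yes _ = Ψ ∪ ｛ ∼ ψ ｝
    ... | no  _ = Ψ ∪ ｛ ψ ｝

    decide-extends : ∀ ψ Ψ → Ψ ⊆ decide ψ Ψ
    decide-extends ψ Ψ with em {Ψ ∪ ｛ ψ ｝ ⊢ φ}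
    ... | yes _ = inj₁
    ... | no  _ = inj₁

    decide-decides : ∀ ψ Ψ → ψ ∈ decide ψ Ψ ⊎ (∼ ψ) ∈ decide ψ Ψ
    decide-decides ψ Ψ with em {Ψ ∪ ｛ ψ ｝ ⊢ φ}
    ... | yes _ = inj₂ (inj₂ refl)
    ... | no  _ = inj₁ (inj₂ refl)

    -- If `ψ` and `∼ ψ` each led to `φ`, then `by-cases` would already derive `φ` from `Ψ`.
    decide-⊬ : ∀ ψ Ψ → ¬ (Ψ ⊢ φ) → ¬ (decide ψ Ψ ⊢ φ)
    decide-⊬ ψ Ψ Ψ⊬φ with em {Ψ ∪ ｛ ψ ｝ ⊢ φ}
    ... | yes d = Ψ⊬φ ∘ by-cases d
    ... | no ¬d = ¬d

    decideAll : List Formula → Pred Formula 0ℓ → Pred Formula 0ℓ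
    decideAll ψs Ψ = foldr decide Ψ ψs

    decideAll-extends : ∀ ψs Ψ → Ψ ⊆ decideAll ψs Ψ
    decideAll-extends []       Ψ = id
    decideAll-extends (ψ ∷ ψs) Ψ =
      decide-extends ψ (decideAll ψs Ψ) ∘ decideAll-extends ψs Ψ

    decideAll-decides : ∀ {ψ ψs} Ψ → ψ ∈ˡ ψs →
                        ψ ∈ decideAll ψs Ψ ⊎ (∼ ψ) ∈ decideAll ψs Ψ
    decideAll-decides {ψs = ψ ∷ ψs} Ψ (here refl) = decide-decides ψ (decideAll ψs Ψ)
    decideAll-decides {ψs = χ ∷ ψs} Ψ (there p) with decideAll-decides Ψ p
    ... | inj₁ q = inj₁ (decide-extends χ (decideAll ψs Ψ) q)
    ... | inj₂ q = inj₂ (decide-extends χ (decideAll ψs Ψ) q)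

    decideAll-⊬ : ∀ ψs Ψ → ¬ (Ψ ⊢ φ) → ¬ (decideAll ψs Ψ ⊢ φ)
    decideAll-⊬ []       Ψ Ψ⊬φ = Ψ⊬φ
    decideAll-⊬ (ψ ∷ ψs) Ψ Ψ⊬φ = decide-⊬ ψ (decideAll ψs Ψ) (decideAll-⊬ ψs Ψ Ψ⊬φ)

    -- A whole stage is settled at each step. A formula recurs in later stages and is then decided
    -- again, which is harmless because every decision keeps `φ` underivable.
    chain : ℕ → Pred Formula 0ℓ
    chain zero    = Φ
    chain (suc k) = decideAll (stage k) (chain k)

    chain-mono : ∀ {k l} → k ≤′ l → chain k ⊆ chain l
    chain-mono ≤′-refl               = id
    chain-mono (≤′-step {n = l} k≤l) =
      decideAll-extends (stage l) (chain l) ∘ chain-mono k≤l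

    chain-⊬ : ∀ k → ¬ (chain k ⊢ φ)
    chain-⊬ zero    = Φ⊬φ
    chain-⊬ (suc k) = decideAll-⊬ (stage k) (chain k) (chain-⊬ k)

    limit : Pred Formula 0ℓ
    limit ψ = ∃[ k ] ψ ∈ chain k

    -- A derivation is finite and the chain increases, so the premises of modus ponens can both be
    -- moved to the later of their two indices.
    limit-compact : ∀ {ψ} → limit ⊢ ψ → ∃[ k ] (chain k ⊢ ψ)
    limit-compact (hyp (k , h)) = k , hyp h
    limit-compact (thm t)       = 0 , thm t
    limit-compact (mp d e) with limit-compact d | limit-compact e
    ... | k , d′ | l , e′ = k ⊔ l ,
      mp (mono (chain-mono (≤⇒≤′ (m≤m⊔n k l))) d′)
         (mono (chain-mono (≤⇒≤′ (m≤n⊔m k l))) e′)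

    limit-⊬ : ¬ (limit ⊢ φ)
    limit-⊬ d with limit-compact d
    ... | k , d′ = chain-⊬ k d′

    limit-decides : ∀ ψ → ψ ∈ limit ⊎ (∼ ψ) ∈ limit
    limit-decides ψ with enumerated ψ
    ... | k , p with decideAll-decides (chain k) p
    ...   | inj₁ q = inj₁ (suc k , q)
    ...   | inj₂ q = inj₂ (suc k , q)

    world : World
    -- Membership is derivability from `limit`, which makes closure under theorems and detachment
    -- immediate.
    world .member ψ = ⌊ em {limit ⊢ ψ} ⌋
    world .theorem t = fromWitness (thm t)
    world .detach p q = fromWitness (mp (toWitness p) (toWitness q))
    world .∼-sound p q =
      -- The conclusion of `explosion` is the avoided formula.
      limit-⊬ (mp (toWitness q) (mp (toWitness p) (thm (explosion _ _))))
    world .∼-compl {ψ} ¬p with limit-decides ψ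
    ... | inj₁ h = contradiction (fromWitness (hyp h)) ¬p
    ... | inj₂ h = fromWitness (hyp h)

    world-extends : ∀ {ψ} → ψ ∈ Φ → world ⊩ ψ
    world-extends h = fromWitness (hyp (0 , h))

    world-avoids : ¬ (world ⊩ φ)
    world-avoids = limit-⊬ ∘ toWitness

  open Lindenbaum using (world; world-extends; world-avoids)

  infix 4 _⟨_⟩_

  _⟨_⟩_ : World → Ag → World → Set
  w ⟨ a ⟩ v = ∀ {ψ} → w ⊩ K a ψ → v ⊩ ψ

  -- Induction on the derivation: `nec` covers theorems and `dist` covers modus ponens.
  K-closed : ∀ w a {φ} → (λ ψ → w ⊩ K a ψ) ⊢ φ → w ⊩ K a φ
  K-closed w a (hyp h)  = h
  K-closed w a (thm t)  = theorem w (nec a t)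
  K-closed w a (mp d e) =
    detach w (K-closed w a d) (detach w (K-closed w a e) (theorem w (dist a _ _)))

  -- If `ψ` is not in `w`, then `∼ ψ` is, and `symm` at `∼ ψ` sends `∼ K a (∼ ∼ ψ)` to `v`. This
  -- contradicts `K a ψ` in `v` after a double negation under `K a`.
  ⟨⟩-sym : ∀ {w a v} → w ⟨ a ⟩ v → v ⟨ a ⟩ w
  ⟨⟩-sym {w} {a} {v} wRv {ψ} vKψ = decidable-stable (T? (member w ψ)) λ w⊮ψ →
    ∼-sound v (wRv (detach w (∼-compl w w⊮ψ) (theorem w (symm a (∼ ψ)))))
      (K-closed v a (mp (hyp vKψ) (thm (∼∼-intro ψ))))

  -- By `K-closed`, `φ` is not derivable from the formulas that `a` knows at `w`. Lindenbaum extends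
  -- these to a world without `φ`, and containing them is exactly being accessible.
  witness : ∀ {w a φ} → ¬ (w ⊩ K a φ) → ∃[ v ] (w ⟨ a ⟩ v) × ¬ (v ⊩ φ)
  witness {w} {a} {φ} ¬Kφ =
    world _ φ ⊬φ , world-extends _ φ ⊬φ , world-avoids _ φ ⊬φ
    where
    ⊬φ : ¬ ((λ ψ → w ⊩ K a ψ) ⊢ φ)
    ⊬φ = ¬Kφ ∘ K-closed w a

  linked : World → World → Pred (Maybe Ag) 0ℓ
  linked w v (just a) = w ⟨ a ⟩ v
  linked w v nothing  = ⊥

  linked-sym : ∀ w v → linked w v ⊆ linked v w
  linked-sym w v {just a} = ⟨⟩-sym {w} {a} {v}

  model : World → SimilarityModel
  model w₀ = record
    { W        = World
    ; nonempty = w₀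
    ; A        = Maybe Ag
    ; E        = linked
    -- With a singleton, `C a ⊆ linked w v` amounts to `w ⟨ a ⟩ v`, so `K a` gets its usual Kripke
    -- clause.
    ; C        = λ a → ｛ just a ｝
    ; ν        = λ w p → w ⊩ atom p
    ; E-full   = λ w v (_ , full) → ⊥-elim (full {nothing} tt)
    ; E-sym    = λ w v → linked-sym w v , linked-sym v w
    }

  module Truth (w₀ : World) where

    -- Both directions go by simultaneous induction on the formula, since negations and antecedents
    -- exchange them.
    ⊨⇒⊩ : ∀ φ w → model w₀ , w ⊨ φ → w ⊩ φ
    ⊩⇒⊨ : ∀ φ w → w ⊩ φ → model w₀ , w ⊨ φ

    ⊨⇒⊩ (atom p) w s = s
    ⊨⇒⊩ (∼ φ)    w s = ∼-compl w (s ∘ ⊩⇒⊨ φ w)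
    ⊨⇒⊩ (φ ⊃ ψ)  w s with T? (member w φ)
    ... | yes p = detach w (⊨⇒⊩ ψ w (s (⊩⇒⊨ φ w p))) (theorem w (weakening ψ φ))
    ... | no ¬p = detach w (∼-compl w ¬p) (theorem w (explosion φ ψ))
    ⊨⇒⊩ (K a φ)  w s = decidable-stable (T? (member w (K a φ))) λ ¬Kφ →
      let v , wRv , v⊮φ = witness {w} ¬Kφ
      in v⊮φ (⊨⇒⊩ φ v (s v λ where refl {ψ} → wRv {ψ}))

    ⊩⇒⊨ (atom p) w f   = f
    ⊩⇒⊨ (∼ φ)    w f s = ∼-sound w f (⊨⇒⊩ φ w s)
    ⊩⇒⊨ (φ ⊃ ψ)  w f s = ⊩⇒⊨ ψ w (detach w (⊨⇒⊩ φ w s) f)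
    ⊩⇒⊨ (K a φ)  w f v C⊆E = ⊩⇒⊨ φ v (C⊆E refl f)

  -- By contradiction: a Lindenbaum world containing `Φ` and omitting `φ` would, by the truth lemma,
  -- be a state satisfying `Φ` but not `φ`.
  complete : ∀ {Φ φ} → Φ ⊨ᴱᴸˢ φ → Φ ⊢ φ
  complete {Φ} {φ} Φ⊨φ = decidable-stable em λ Φ⊬φ →
    let w = world Φ φ Φ⊬φ
        open Truth w
    in world-avoids Φ φ Φ⊬φ
         (⊨⇒⊩ φ w (Φ⊨φ (model w) w λ ψ h → ⊩⇒⊨ ψ w (world-extends Φ φ Φ⊬φ h)))

theorem22 : ExcludedMiddle 0ℓ →
    (Atom Ag : Set) (atoms : ℕ ↔ Atom) (n : ℕ) (agents : Fin (suc n) ↔ Ag) →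
    let open EL Atom Ag atoms in
    (φ : Formula) (Φ : Pred Formula 0ℓ) →
    Φ ⊨ᴱᴸˢ φ → Φ ⊢ᴷᴮ φ
theorem22 em Atom Ag atoms n agents φ Φ Φ⊨φ = ⊢⇒⊢ᴷᴮ (complete Φ⊨φ)
  where
  open Deduction Atom Ag atoms
  open Canonical em Atom Ag atoms agents
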